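{- Let $G$ be a connected graph and let $v$ be a simplicial vertex of $G$ with $\deg(v)\geq 2$. Let $e$ be an edge incident to $v$ and let $G'=G\setminus\{e\}$. Then $$meg(G)-\deg(v)\leq meg(G')\leq meg(G)+1,$$ where $\deg(v)$ is the degree of $v$ in $G$.
   Context: Graphs are finite, undirected and simple. A simplicial vertex is a vertex whose neighbourhood induces a clique. In a connected graph $H$, an edge $e$ is monitored by a pair of vertices $x,y$ if $e$ lies on all shortest paths between $x$ and $y$. A set $M\subseteq V(H)$ is a monitoring edge-geodetic set (MEG-set) of $H$ if every edge of $H$ is monitored by some pair of vertices of $M$; $meg(H)$ is the minimum size of a MEG-set of $H$. -}

module Defs where

open import Data.Bool using (Bool; true; false; T; not; _∧_)
open import Data.Bool.Properties using (T?; T-irrelevant)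
open import Data.Empty using (⊥; ⊥-elim)
open import Data.Fin using (Fin; zero; suc)
open import Data.Fin.Properties using (_≟_; any?; all?; injective⇒≤)
open import Data.Fin.Subset using (Subset; _∈_; ∣_∣; ⊤)
open import Data.Fin.Subset.Properties using (_∈?_; ∈⊤; anySubset?)
open import Data.List as List using (List; []; _∷_)
open import Data.List.Membership.Propositional.Properties using (∈-lookup)
import Data.List.Relation.Unary.All as All
open import Data.List.Relation.Unary.All using ([]; _∷_)
open import Data.List.Relation.Unary.AllPairs using ([]; _∷_)
open import Data.List.Relation.Unary.Unique.Propositional using (Unique)
open import Data.Nat using (ℕ; zero; suc; _≤_; _<_; z≤n; s≤s; _≤?_)
import Data.Nat.Properties as ℕ
open import Data.Nat.Induction using (<-rec)
open import Data.Product using (_×_; _,_; ∃; ∃₂; proj₁; proj₂)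
open import Data.Sum using (_⊎_; inj₁; inj₂)
open import Data.Vec using (tabulate)
open import Function using (_∘_)
open import Relation.Binary.PropositionalEquality
  using (_≡_; _≢_; refl; sym; cong; cong₂; subst)
open import Relation.Nullary
  using (Dec; yes; no; does; map′; _×-dec_; _⊎-dec_; _→-dec_)
open import Relation.Nullary.Decidable using (does-⇔)
open import Function.Bundles using (mk⇔)

import Data.List.Relation.Unary.Unique.DecPropositional as DecUnique

-- Boolean adjacency makes "finite simple graph" proof-irrelevant and decidable.
record Graph (n : ℕ) : Set where
  field
    adj        : Fin n → Fin n → Bool
    adj-sym    : ∀ x y → adj x y ≡ adj y x
    adj-irrefl : ∀ x → adj x x ≡ false

  Adj : Fin n → Fin n → Set
  Adj x y = T (adj x y)

open Graph public

SameEdge : ∀ {n} → Fin n → Fin n → Fin n → Fin n → Set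
SameEdge x y u w = (x ≡ u × y ≡ w) ⊎ (x ≡ w × y ≡ u)

sameEdge? : ∀ {n} (x y u w : Fin n) → Dec (SameEdge x y u w)
sameEdge? x y u w = ((x ≟ u) ×-dec (y ≟ w)) ⊎-dec ((x ≟ w) ×-dec (y ≟ u))

deleteEdge : ∀ {n} → Graph n → Fin n → Fin n → Graph n
deleteEdge G u w = record
  { adj        = λ x y → adj G x y ∧ not (does (sameEdge? x y u w))
  ; adj-sym    = λ x y → cong₂ (λ a b → a ∧ not b) (adj-sym G x y)
      (does-⇔ (mk⇔ (flip x y) (flip y x)) (sameEdge? x y u w) (sameEdge? y x u w))
  ; adj-irrefl = λ x → cong (_∧ not (does (sameEdge? x x u w))) (adj-irrefl G x)
  }
  where
  flip : ∀ x y → SameEdge x y u w → SameEdge y x u w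
  flip x y (inj₁ (p , q)) = inj₂ (q , p)
  flip x y (inj₂ (p , q)) = inj₁ (q , p)

neighbourhood : ∀ {n} → Graph n → Fin n → Subset n
neighbourhood G v = tabulate (adj G v)

degree : ∀ {n} → Graph n → Fin n → ℕ
degree G v = ∣ neighbourhood G v ∣

Simplicial : ∀ {n} → Graph n → Fin n → Set
Simplicial G v = ∀ x y → x ∈ neighbourhood G v → y ∈ neighbourhood G v →
                 x ≢ y → Adj G x y

data Walk {n : ℕ} (G : Graph n) : Fin n → Fin n → Set where
  nil  : ∀ {x} → Walk G x x
  step : ∀ {x y z} → Adj G x y → Walk G y z → Walk G x z

Connected : ∀ {n} → Graph n → Set
Connected G = ∀ x y → Walk G x y

length : ∀ {n} {G : Graph n} {x y} → Walk G x y → ℕ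
length nil        = 0
length (step _ p) = suc (length p)

vertices : ∀ {n} {G : Graph n} {x y} → Walk G x y → List (Fin n)
vertices {x = x} nil        = x ∷ []
vertices {x = x} (step _ p) = x ∷ vertices p

IsPath : ∀ {n} {G : Graph n} {x y} → Walk G x y → Set
IsPath p = Unique (vertices p)

IsShortestPath : ∀ {n} {G : Graph n} {x y} → Walk G x y → Set
IsShortestPath {G = G} {x} {y} p =
  IsPath p × (∀ (q : Walk G x y) → IsPath q → length p ≤ length q)

EdgeOn : ∀ {n} {G : Graph n} {x y} → Fin n → Fin n → Walk G x y → Set
EdgeOn u w nil                = ⊥
EdgeOn u w (step {x} {y} _ p) = SameEdge x y u w ⊎ EdgeOn u w p

-- Meaningful only when x and y are joined by a path: it is vacuously true
-- otherwise, so MEG-sets and meg are to be used for connected graphs only.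
Monitors : ∀ {n} → Graph n → (x y u w : Fin n) → Set
Monitors G x y u w = (p : Walk G x y) → IsShortestPath p → EdgeOn u w p

IsMEG : ∀ {n} → Graph n → Subset n → Set
IsMEG G M = ∀ u w → Adj G u w → ∃₂ λ x y → x ∈ M × y ∈ M × Monitors G x y u w

IsMinMEGSize : ∀ {n} → Graph n → ℕ → Set
IsMinMEGSize G k =
  (∃ λ M → IsMEG G M × ∣ M ∣ ≡ k) × (∀ M → IsMEG G M → k ≤ ∣ M ∣)

lookup-injective : ∀ {n} {xs : List (Fin n)} → Unique xs →
                   ∀ {i j} → List.lookup xs i ≡ List.lookup xs j → i ≡ j
lookup-injective (x≢ ∷ u) {zero}  {zero}  eq = refl
lookup-injective (x≢ ∷ u) {zero}  {suc j} eq = ⊥-elim (All.lookup x≢ (∈-lookup j) eq)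
lookup-injective (x≢ ∷ u) {suc i} {zero}  eq = ⊥-elim (All.lookup x≢ (∈-lookup i) (sym eq))
lookup-injective (x≢ ∷ u) {suc i} {suc j} eq = cong suc (lookup-injective u eq)

length-vertices : ∀ {n} {G : Graph n} {x y} (p : Walk G x y) →
                  List.length (vertices p) ≡ suc (length p)
length-vertices nil        = refl
length-vertices (step _ p) = cong suc (length-vertices p)

-- Bounds the search that decides IsMEG.
path-length< : ∀ {n} {G : Graph n} {x y} (p : Walk G x y) → IsPath p → length p < n
path-length< {n} p u =
  subst (_≤ n) (length-vertices p) (injective⇒≤ (lookup-injective u))

module _ {n} {G : Graph n} where

  allWalksOfLength? : ∀ k {x y} {P : Walk G x y → Set} → (∀ p → Dec (P p)) →
                      Dec (∀ p → length p ≡ k → P p)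
  allWalksOfLength? zero {x} {y} P? with x ≟ y
  ... | no x≢y   = yes λ { nil _ → ⊥-elim (x≢y refl) }
  ... | yes refl = map′ (λ { Pn nil _ → Pn }) (λ f → f nil refl) (P? nil)
  allWalksOfLength? (suc k) {x} {y} {P} P? =
    map′ (λ { f (step a p) eq → f _ a p (ℕ.suc-injective eq) })
         (λ f z a p eq → f (step a p) (cong suc eq))
         (all? next?)
    where
    next? : ∀ z → Dec ((a : Adj G x z) (p : Walk G z y) → length p ≡ k → P (step a p))
    next? z with T? (adj G x z)
    ... | no ¬a = yes λ a → ⊥-elim (¬a a)
    ... | yes a = map′ (λ f a′ p eq → subst (λ b → P (step b p)) (T-irrelevant a a′) (f p eq))
                       (λ f → f a)
                       (allWalksOfLength? k (P? ∘ step a))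

  allPaths? : ∀ {x y} {P : Walk G x y → Set} → (∀ p → Dec (P p)) →
              Dec (∀ p → IsPath p → P p)
  allPaths? {x} {y} {P} P? =
    map′ (λ (f : ∀ {k} → k < n → Bounded k) p u → f (path-length< p u) p refl u)
         (λ f {k} _ p _ u → f p u)
         (ℕ.allUpTo? (λ k → allWalksOfLength? k (λ p → isPath? p →-dec P? p)) n)
    where
    Bounded : ℕ → Set
    Bounded k = (p : Walk G x y) → length p ≡ k → IsPath p → P p

    isPath? : ∀ {x y} (p : Walk G x y) → Dec (IsPath p)
    isPath? p = DecUnique.unique? _≟_ (vertices p)

  edgeOn? : ∀ u w {x y} (p : Walk G x y) → Dec (EdgeOn u w p)
  edgeOn? u w nil                = no λ ()
  edgeOn? u w (step {x} {y} _ p) = sameEdge? x y u w ⊎-dec edgeOn? u w p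

  monitors? : ∀ x y u w → Dec (Monitors G x y u w)
  monitors? x y u w =
    map′ (λ f p s → f p (proj₁ s) (proj₂ s)) (λ f p u m → f p (u , m))
         (allPaths? λ p → allPaths? (λ q → length p ≤? length q) →-dec edgeOn? u w p)

isMEG? : ∀ {n} (G : Graph n) (M : Subset n) → Dec (IsMEG G M)
isMEG? G M = all? λ u → all? λ w → T? (adj G u w) →-dec
  any? λ x → any? λ y → (x ∈? M) ×-dec (y ∈? M) ×-dec monitors? x y u w

⊤-isMEG : ∀ {n} (G : Graph n) → IsMEG G ⊤
⊤-isMEG G u w a = u , w , ∈⊤ , ∈⊤ , λ p s → on p (proj₂ s edge ((u≢w ∷ []) ∷ [] ∷ []))
  where
  u≢w : u ≢ w
  u≢w refl = subst T (adj-irrefl G u) a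

  edge : Walk G u w
  edge = step a nil

  on : (p : Walk G u w) → length p ≤ 1 → EdgeOn u w p
  on nil                 _        = ⊥-elim (u≢w refl)
  on (step _ nil)        _        = inj₁ (inj₁ (refl , refl))
  on (step _ (step _ _)) (s≤s ())

least : {P : ℕ → Set} → (∀ k → Dec (P k)) → ∀ k → P k →
        ∃ λ m → P m × (∀ j → P j → m ≤ j)
least {P} P? = <-rec _ λ k rec Pk → search k rec Pk (ℕ.anyUpTo? P? k)
  where
  Least : Set
  Least = ∃ λ m → P m × (∀ j → P j → m ≤ j)

  search : ∀ k → (∀ {j} → j < k → P j → Least) → P k →
           Dec (∃ λ j → j < k × P j) → Least
  search k rec Pk (yes (j , j<k , Pj)) = rec j<k Pj
  search k rec Pk (no none) = k , Pk , λ j Pj → ℕ.≮⇒≥ λ j<k → none (j , j<k , Pj)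

minMEGSize : ∀ {n} (G : Graph n) → ∃ (IsMinMEGSize G)
minMEGSize {n} G with least (λ k → anySubset? λ M → isMEG? G M ×-dec (∣ M ∣ ℕ.≟ k))
                        ∣ ⊤ {n} ∣ (⊤ , ⊤-isMEG G , refl)
... | k , attained , lower = k , attained , λ M meg → lower ∣ M ∣ (M , meg , refl)

meg : ∀ {n} → Graph n → ℕ
meg G = proj₁ (minMEGSize G)

meg-isMin : ∀ {n} (G : Graph n) → IsMinMEGSize G (meg G)
meg-isMin G = proj₂ (minMEGSize G)

{-# OPTIONS --safe #-}

-- No shortest path passes through a simplicial vertex v as an inner vertex, so v
-- lies in every MEG-set of G and of G' = G \ vu, and between vertices other than v
-- the two graphs have the same shortest paths.  Only pairs (v , b) need care.
-- Upper bound: M ∪ {u} works for G', since either d(v , b) is unchanged and (v , b)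
-- still monitors, or every shortest path from v to b starts with vu and (u , b)
-- takes over.  Lower bound: M ∪ N(v) works for G, since (v , b) can be replaced
-- by (w , b) with w the first vertex after v on a shortest path of G' to b.
module Submission where

open import Defs
open import Data.Bool using (T; not)
open import Data.Bool.Properties using (T?; T-≡; T-∧)
open import Data.Empty using (⊥-elim)
open import Data.Fin using (Fin)
open import Data.Fin.Properties using (_≟_; any?)
open import Data.Fin.Subset using (Subset; inside; outside; _∈_; _∪_; ∣_∣; ⁅_⁆)
open import Data.Fin.Subset.Properties using (p⊆p∪q; q⊆p∪q; p⊆q⇒∣p∣≤∣q∣; ∣⁅x⁆∣≡1; x∈⁅x⁆)
open import Data.List.Membership.Propositional using () renaming (_∈_ to _∈ˡ_)
open import Data.List.Relation.Unary.All using ([])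
open import Data.List.Relation.Unary.All.Properties using (¬Any⇒All¬)
open import Data.List.Relation.Unary.AllPairs using ([]; _∷_)
open import Data.List.Relation.Unary.Any using (here; there)
open import Data.Nat using (ℕ; zero; suc; _+_; _∸_; _≤_; _<_; z≤n; s≤s; _≤?_)
open import Data.Nat.Properties hiding (_≟_)
open import Data.Product using (_×_; _,_; ∃; ∃₂; Σ; proj₁; proj₂)
open import Data.Sum using (_⊎_; inj₁; inj₂)
open import Data.Vec using ([]; _∷_)
open import Data.Vec.Properties using (lookup⇒[]=; []=⇒lookup; lookup∘tabulate)
open import Function using (_∘_; id; Equivalence)
open import Relation.Binary.PropositionalEquality
  using (_≡_; _≢_; refl; sym; trans; cong; cong₂; subst)
open import Relation.Nullary using (Dec; yes; no; does; ¬_; contradiction; _×-dec_)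
open import Relation.Nullary.Decidable using (map′; ¬?; decidable-stable)

-- Subset sizes, adjacency and neighbourhoods.

∣p∪q∣≤∣p∣+∣q∣ : ∀ {n} (p q : Subset n) → ∣ p ∪ q ∣ ≤ ∣ p ∣ + ∣ q ∣
∣p∪q∣≤∣p∣+∣q∣ []            []            = z≤n
∣p∪q∣≤∣p∣+∣q∣ (outside ∷ p) (outside ∷ q) = ∣p∪q∣≤∣p∣+∣q∣ p q
∣p∪q∣≤∣p∣+∣q∣ (outside ∷ p) (inside  ∷ q) =
  subst (suc ∣ p ∪ q ∣ ≤_) (sym (+-suc ∣ p ∣ ∣ q ∣)) (s≤s (∣p∪q∣≤∣p∣+∣q∣ p q))
∣p∪q∣≤∣p∣+∣q∣ (inside  ∷ p) (outside ∷ q) = s≤s (∣p∪q∣≤∣p∣+∣q∣ p q)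
∣p∪q∣≤∣p∣+∣q∣ (inside  ∷ p) (inside  ∷ q) =
  s≤s (≤-trans (∣p∪q∣≤∣p∣+∣q∣ p q) (+-monoʳ-≤ ∣ p ∣ (n≤1+n ∣ q ∣)))

T-not-does⁺ : ∀ {P : Set} (P? : Dec P) → ¬ P → T (not (does P?))
T-not-does⁺ (yes p) ¬p = ¬p p
T-not-does⁺ (no _)  _  = _

T-not-does⁻ : ∀ {P : Set} (P? : Dec P) → T (not (does P?)) → ¬ P
T-not-does⁻ (no ¬p) _ = ¬p

SameEdge-flip : ∀ {n} {x y s t : Fin n} → SameEdge x y s t → SameEdge y x s t
SameEdge-flip (inj₁ (p , q)) = inj₂ (q , p)
SameEdge-flip (inj₂ (p , q)) = inj₁ (q , p)

module _ {n} (G : Graph n) where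

  Adj-sym : ∀ {x y} → Adj G x y → Adj G y x
  Adj-sym {x} {y} = subst T (adj-sym G x y)

  Adj⇒≢ : ∀ {x y} → Adj G x y → x ≢ y
  Adj⇒≢ {x} a refl = subst T (adj-irrefl G x) a

  Adj⇒∈ : ∀ {x y} → Adj G x y → y ∈ neighbourhood G x
  Adj⇒∈ {x} {y} a =
    lookup⇒[]= y _ (trans (lookup∘tabulate (adj G x) y) (Equivalence.to T-≡ a))

  ∈⇒Adj : ∀ {x y} → y ∈ neighbourhood G x → Adj G x y
  ∈⇒Adj {x} {y} m =
    Equivalence.from T-≡ (trans (sym (lookup∘tabulate (adj G x) y)) ([]=⇒lookup m))

  -- Otherwise the neighbourhood would lie in `⁅ u ⁆`, making the degree at most 1.
  another-neighbour : ∀ x u → 2 ≤ degree G x → ∃ λ w → Adj G x w × w ≢ u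
  another-neighbour x u 2≤deg with any? (λ w → T? (adj G x w) ×-dec ¬? (w ≟ u))
  ... | yes found = found
  ... | no  none  = contradiction 2≤deg (≤⇒≯ deg≤1)
    where
    only-u : ∀ {w} → w ∈ neighbourhood G x → w ∈ ⁅ u ⁆
    only-u {w} w∈N = subst (_∈ ⁅ u ⁆)
      (sym (decidable-stable (w ≟ u) λ w≢u → none (w , ∈⇒Adj w∈N , w≢u))) (x∈⁅x⁆ u)

    deg≤1 : degree G x ≤ 1
    deg≤1 = ≤-trans (p⊆q⇒∣p∣≤∣q∣ only-u) (≤-reflexive (∣⁅x⁆∣≡1 u))

-- Geodesics and reversal of walks.

module _ {n} {G : Graph n} where

  -- Competitors range over all walks, not only paths as in `IsShortestPath`, so spliced or rerouted
  -- walks can be compared without showing that they are paths.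
  Geodesic : ∀ {x y} → Walk G x y → Set
  Geodesic {x} {y} p = ∀ (q : Walk G x y) → length p ≤ length q

  walkOfLength? : ∀ k x y → Dec (∃ λ (p : Walk G x y) → length p ≡ k)
  walkOfLength? zero x y with x ≟ y
  ... | yes refl = yes (nil , refl)
  ... | no  x≢y  = no λ { (nil , _) → x≢y refl }
  walkOfLength? (suc k) x y =
    map′ (λ { (z , a , p , eq) → step a p , cong suc eq })
         (λ { (step a p , eq) → _ , a , p , suc-injective eq })
         (any? λ z → T? (adj G x z) ×-dec walkOfLength? k z y)

  geodesic : ∀ {x y} → Walk G x y → Σ (Walk G x y) Geodesic
  geodesic {x} {y} p with least (λ k → walkOfLength? k x y) (length p) (p , refl)
  ... | _ , (q , refl) , minimal = q , λ r → minimal (length r) (r , refl)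

  suffix : ∀ {x y z} (p : Walk G x y) → z ∈ˡ vertices p →
           ∃ λ (q : Walk G z y) → length q ≤ length p
  suffix nil        (here refl) = nil , z≤n
  suffix (step a p) (here refl) = step a p , ≤-refl
  suffix (step a p) (there z∈p) with suffix p z∈p
  ... | q , q≤p = q , m≤n⇒m≤1+n q≤p

  -- If a vertex recurred, the suffix from its later occurrence would be strictly shorter.
  geodesic⇒path : ∀ {x y} (p : Walk G x y) → Geodesic p → IsPath p
  geodesic⇒path nil        _   = [] ∷ []
  geodesic⇒path (step a p) geo =
    ¬Any⇒All¬ _ (λ x∈p → let q , q≤p = suffix p x∈p in <⇒≱ (s≤s q≤p) (geo q)) ∷
    geodesic⇒path p (λ q → ≤-pred (geo (step a q)))

  geodesic⇒shortest : ∀ {x y} {p : Walk G x y} → Geodesic p → IsShortestPath p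
  geodesic⇒shortest {p = p} geo = geodesic⇒path p geo , λ q _ → geo q

  -- A walk of least length is itself a path, so it is among the competitors of `p`.
  shortest⇒geodesic : ∀ {x y} {p : Walk G x y} → IsShortestPath p → Geodesic p
  shortest⇒geodesic (_ , shortest) q with geodesic q
  ... | r , geo = ≤-trans (shortest r (geodesic⇒path r geo)) (geo q)

  snoc : ∀ {x y z} → Walk G x y → Adj G y z → Walk G x z
  snoc nil        b = step b nil
  snoc (step a p) b = step a (snoc p b)

  length-snoc : ∀ {x y z} (p : Walk G x y) (b : Adj G y z) →
                length (snoc p b) ≡ suc (length p)
  length-snoc nil        b = refl
  length-snoc (step a p) b = cong suc (length-snoc p b)

  EdgeOn-snoc : ∀ {x y z s t} (p : Walk G x y) (b : Adj G y z) →
                EdgeOn s t (snoc p b) → SameEdge y z s t ⊎ EdgeOn s t p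
  EdgeOn-snoc nil        b (inj₁ e) = inj₁ e
  EdgeOn-snoc (step a p) b (inj₁ e) = inj₂ (inj₁ e)
  EdgeOn-snoc (step a p) b (inj₂ o) with EdgeOn-snoc p b o
  ... | inj₁ e  = inj₁ e
  ... | inj₂ o′ = inj₂ (inj₂ o′)

  reverse : ∀ {x y} → Walk G x y → Walk G y x
  reverse nil        = nil
  reverse (step a p) = snoc (reverse p) (Adj-sym G a)

  length-reverse : ∀ {x y} (p : Walk G x y) → length (reverse p) ≡ length p
  length-reverse nil        = refl
  length-reverse (step a p) =
    trans (length-snoc (reverse p) (Adj-sym G a)) (cong suc (length-reverse p))

  EdgeOn-reverse : ∀ {x y s t} (p : Walk G x y) → EdgeOn s t (reverse p) → EdgeOn s t p
  EdgeOn-reverse (step a p) o with EdgeOn-snoc (reverse p) (Adj-sym G a) o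
  ... | inj₁ e  = inj₁ (SameEdge-flip e)
  ... | inj₂ o′ = inj₂ (EdgeOn-reverse p o′)

  geodesic-reverse : ∀ {x y} {p : Walk G x y} → Geodesic p → Geodesic (reverse p)
  geodesic-reverse {p = p} geo q rewrite length-reverse p | sym (length-reverse q) =
    geo (reverse q)

-- Monitoring pairs.

module _ {n} {G : Graph n} {s t : Fin n} where

  -- Lets a pair containing `v` always be treated with `v` in first position.
  monitors-sym : ∀ {x y} → Monitors G x y s t → Monitors G y x s t
  monitors-sym mon p shortest = EdgeOn-reverse p (mon (reverse p)
    (geodesic⇒shortest (geodesic-reverse {p = p} (shortest⇒geodesic {p = p} shortest))))

  ¬monitors-self : ∀ {x} → ¬ Monitors G x x s t
  ¬monitors-self mon = mon nil (geodesic⇒shortest {p = nil} λ _ → z≤n)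

  monitors-endpoints : Adj G s t → Monitors G s t s t
  monitors-endpoints a p shortest = on p (shortest⇒geodesic {p = p} shortest (step a nil))
    where
    on : (p : Walk G s t) → length p ≤ 1 → EdgeOn s t p
    on nil                 _        = ⊥-elim (Adj⇒≢ G a refl)
    on (step _ nil)        _        = inj₁ (inj₁ (refl , refl))
    on (step _ (step _ _)) (s≤s ())

-- Bypassing a simplicial vertex.

NeighboursAdjacent : ∀ {n} → Graph n → Fin n → Set
NeighboursAdjacent G v = ∀ {x y} → Adj G v x → Adj G v y → x ≢ y → Adj G x y

-- `G` and `G′` are related this way in both directions, so one rerouting argument serves both, and
-- also `G` with itself.
AdjOff : ∀ {n} → Fin n → Graph n → Graph n → Set
AdjOff v A B = ∀ {x y} → x ≢ v → y ≢ v → Adj A x y → Adj B x y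

module _ {n} {A B : Graph n} {v : Fin n}
         (A⇒B : AdjOff v A B) (clique : NeighboursAdjacent A v) where

  record Detour {x y} (p : Walk A x y) : Set where
    field
      walk    : Walk B x y
      shorter : length walk ≤ length p
      -- Strictly shorter detours may use new edges.
      edges   : length p ≤ length walk → ∀ {s t} → EdgeOn s t walk → EdgeOn s t p
      avoids  : ∀ {t} → ¬ EdgeOn v t walk

  detour-step : ∀ {x y z} → x ≢ v → z ≢ v → y ≢ v →
                (a : Adj A x z) (p : Walk A z y) → Detour p → Detour (step a p)
  detour-step x≢v z≢v y≢v a p d = record
    { walk    = step (A⇒B x≢v z≢v a) walk
    ; shorter = s≤s shorter
    ; edges   = λ { _          (inj₁ e) → inj₁ e
                  ; (s≤s long) (inj₂ o) → inj₂ (edges long o) }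
    ; avoids  = λ { (inj₁ (inj₁ (x≡v , _))) → x≢v x≡v
                  ; (inj₁ (inj₂ (_ , z≡v))) → z≢v z≡v
                  ; (inj₂ o)                → avoids o }
    }
    where open Detour d

  -- If `m` is `v`, the two edges at `v` are dropped when the walk turns back to `x`, and replaced
  -- by the chord from `x` to `z` otherwise. Either way the walk gets strictly shorter.
  detour-step₂ : ∀ {x m z y} → x ≢ v → y ≢ v →
                 (a : Adj A x m) (b : Adj A m z) (q : Walk A z y) →
                 (m ≢ v → Detour (step b q)) → (z ≢ v → Detour q) →
                 Detour (step a (step b q))
  detour-step₂ {x} {m} {z} x≢v y≢v a b q via skip with m ≟ v | x ≟ z
  ... | no m≢v   | _        = detour-step x≢v m≢v y≢v a (step b q) (via m≢v)
  ... | yes refl | yes refl = record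
    { walk    = walk
    ; shorter = m≤n⇒m≤1+n (m≤n⇒m≤1+n shorter)
    ; edges   = λ long → contradiction long (<⇒≱ (s≤s (m≤n⇒m≤1+n shorter)))
    ; avoids  = avoids
    }
    where open Detour (skip x≢v)
  ... | yes refl | no x≢z   = record
    { walk    = walk
    ; shorter = m≤n⇒m≤1+n shorter
    ; edges   = λ long → contradiction long (<⇒≱ (s≤s shorter))
    ; avoids  = avoids
    }
    where
    z≢v = Adj⇒≢ A b ∘ sym
    c   = clique (Adj-sym A a) b x≢z
    open Detour (detour-step x≢v z≢v y≢v c q (skip z≢v))

  -- Looking two edges ahead suffices: both ends differ from `v`, so each visit to `v` has an edge
  -- before it and an edge after it.
  detour : ∀ {x y} → x ≢ v → y ≢ v → (p : Walk A x y) → Detour p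
  detour x≢v y≢v nil = record
    { walk = nil ; shorter = z≤n ; edges = λ _ → id ; avoids = λ () }
  detour x≢v y≢v (step a nil) = detour-step x≢v y≢v y≢v a nil (detour y≢v y≢v nil)
  detour x≢v y≢v (step a (step b q)) = detour-step₂ x≢v y≢v a b q
    (λ m≢v → detour m≢v y≢v (step b q)) (λ z≢v → detour z≢v y≢v q)

-- If neither `x` nor `y` were `v`, the detour of a shortest walk between them would be shortest
-- too, yet would miss the edge from `v` to `w`.
∈-MEG : ∀ {n} {G : Graph n} {v w M} → (∀ {x y} → y ≢ v → Walk G x y) →
        NeighboursAdjacent G v → Adj G v w → IsMEG G M → v ∈ M
∈-MEG {G = G} {v} {w} {M} walkTo clique a meg with meg v w a
... | x , y , x∈M , y∈M , mon with x ≟ v | y ≟ v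
... | yes refl | _        = x∈M
... | no _     | yes refl = y∈M
... | no x≢v   | no y≢v   = contradiction
  (mon walk (geodesic⇒shortest {p = walk} λ q → ≤-trans shorter (proj₂ shortest q)))
  avoids
  where
  shortest = geodesic (walkTo {x} {y} y≢v)
  open Detour (detour {A = G} {B = G} (λ _ _ → id) clique x≢v y≢v (proj₁ shortest))

-- The detour in `A` of a shortest path `p` of `B` is shortest in `A`, so it carries the monitored
-- edge. It is as long as `p`, so `edges` puts that edge on `p`.
monitors-off : ∀ {n} {A B : Graph n} {v x y s t} → AdjOff v A B → AdjOff v B A →
               NeighboursAdjacent A v → NeighboursAdjacent B v → x ≢ v → y ≢ v →
               Monitors A x y s t → Monitors B x y s t
monitors-off {A = A} {B} A⇒B B⇒A cliqueA cliqueB x≢v y≢v mon p shortest =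
  edges (minimal walk)
    (mon walk (geodesic⇒shortest {p = walk} λ q → ≤-trans shorter (minimal q)))
  where
  open Detour (detour {A = B} {B = A} B⇒A cliqueB x≢v y≢v p)

  -- Rerouting `q` into `B` makes it comparable with `p`.
  minimal : (q : Walk A _ _) → length p ≤ length q
  minimal q = ≤-trans (shortest⇒geodesic {p = p} shortest (Detour.walk d)) (Detour.shorter d)
    where d = detour {A = A} {B = B} A⇒B cliqueA x≢v y≢v q

-- Deleting an edge at `v`.

module DeleteEdge {n} (G : Graph n) (v u : Fin n) where

  G′ : Graph n
  G′ = deleteEdge G v u

  Adj-delete⁻ : ∀ {x y} → Adj G′ x y → Adj G x y
  Adj-delete⁻ = proj₁ ∘ Equivalence.to T-∧

  Adj-delete-≢ : ∀ {x y} → Adj G′ x y → ¬ SameEdge x y v u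
  Adj-delete-≢ {x} {y} a =
    T-not-does⁻ (sameEdge? x y v u) (proj₂ (Equivalence.to (T-∧ {adj G x y}) a))

  Adj-delete⁺ : ∀ {x y} → Adj G x y → ¬ SameEdge x y v u → Adj G′ x y
  Adj-delete⁺ {x} {y} a ¬e = Equivalence.from T-∧ (a , T-not-does⁺ (sameEdge? x y v u) ¬e)

  include : ∀ {x y} → Walk G′ x y → Walk G x y
  include nil        = nil
  include (step a p) = step (Adj-delete⁻ a) (include p)

  length-include : ∀ {x y} (p : Walk G′ x y) → length (include p) ≡ length p
  length-include nil        = refl
  length-include (step a p) = cong suc (length-include p)

  EdgeOn-include : ∀ {x y s t} (p : Walk G′ x y) → EdgeOn s t (include p) → EdgeOn s t p
  EdgeOn-include (step a p) (inj₁ e) = inj₁ e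
  EdgeOn-include (step a p) (inj₂ o) = inj₂ (EdgeOn-include p o)

  off⁻ : AdjOff v G′ G
  off⁻ _ _ = Adj-delete⁻

  off⁺ : AdjOff v G G′
  off⁺ x≢v y≢v a = Adj-delete⁺ a λ { (inj₁ (x≡v , _)) → x≢v x≡v ; (inj₂ (_ , y≡v)) → y≢v y≡v }

module _ {n} (G : Graph n) (connected : Connected G) (v : Fin n)
         (clique : NeighboursAdjacent G v) (2≤deg : 2 ≤ degree G v)
         (u : Fin n) (vu : Adj G v u) where

  open DeleteEdge G v u

  -- An edge joining two neighbours of `v` does not meet `v`, so it survives the deletion.
  clique′ : NeighboursAdjacent G′ v
  clique′ a b x≢y = off⁺ (Adj⇒≢ G′ a ∘ sym) (Adj⇒≢ G′ b ∘ sym)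
    (clique (Adj-delete⁻ a) (Adj-delete⁻ b) x≢y)

  detour⁺ : ∀ {x y} → x ≢ v → y ≢ v → (p : Walk G x y) →
            ∃ λ (q : Walk G′ x y) → length q ≤ length p
  detour⁺ x≢v y≢v p = Detour.walk d , Detour.shorter d
    where d = detour {A = G} {B = G′} off⁺ clique x≢v y≢v p

  Adj-other : ∀ {w} → Adj G v w → w ≢ u → Adj G′ v w
  Adj-other a w≢u = Adj-delete⁺ a
    λ { (inj₁ (_ , w≡u)) → w≢u w≡u ; (inj₂ (_ , w≡v)) → Adj⇒≢ G a (sym w≡v) }

  u≢v : u ≢ v
  u≢v = Adj⇒≢ G vu ∘ sym

  neighbour′ : ∃ λ w → Adj G′ v w
  neighbour′ with another-neighbour G v u 2≤deg
  ... | w , a , w≢u = w , Adj-other a w≢u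

  -- Elsewhere a walk of `G` can bypass `v`; from `v` itself it leaves through a neighbour other
  -- than `u`, which exists as the degree is at least 2.
  walk′ : ∀ {x y} → y ≢ v → Walk G′ x y
  walk′ {x} {y} y≢v with x ≟ v
  ... | no x≢v   = proj₁ (detour⁺ x≢v y≢v (connected x y))
  ... | yes refl with neighbour′
  ...   | w , a = step a (proj₁ (detour⁺ (Adj⇒≢ G′ a ∘ sym) y≢v (connected w y)))

  -- Upper bound: adding `u` to a MEG-set of `G`.

  -- If deleting vu increases d(v , b), every shortest path from v to b starts with vu.
  suc-dist-u : ∀ {b} → b ≢ v → (q : Walk G v b) →
               (∀ (r : Walk G′ v b) → length q < length r) →
               (p : Walk G′ u b) → Geodesic p → suc (length p) ≤ length q
  suc-dist-u b≢v nil          _      _ _   = contradiction refl b≢v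
  suc-dist-u b≢v (step {y = w} a q) longer p geo
    with w ≟ u | detour⁺ (Adj⇒≢ G a ∘ sym) b≢v q
  ... | yes refl | r , r≤q = s≤s (≤-trans (geo r) r≤q)
  ... | no w≢u   | r , r≤q = contradiction (s≤s r≤q) (<⇒≱ (longer (step (Adj-other a w≢u) r)))

  monitors-delete : ∀ {b s t} → b ≢ v → Adj G′ s t → Monitors G v b s t →
                    Monitors G′ v b s t ⊎ Monitors G′ u b s t
  monitors-delete {b} b≢v st mon
    with geodesic (walk′ {v} b≢v) | geodesic (connected v b)
  ... | p₀ , geo₀ | q₀ , geo with length p₀ ≤? length q₀
  -- The distance is unchanged, so a shortest path of `G′` is still shortest in `G`.
  ... | yes p₀≤q₀ = inj₁ λ p shortest → EdgeOn-include p
    (mon (include p) (geodesic⇒shortest {p = include p} λ q →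
      ≤-trans (≤-reflexive (length-include p))
        (≤-trans (shortest⇒geodesic {p = p} shortest p₀) (≤-trans p₀≤q₀ (geo q)))))
  ... | no p₀≰q₀  = inj₂ on
    where
    on : Monitors G′ u b _ _
    -- Prepending `vu` to `p` gives a shortest path of `G`. The monitored edge lies in `G′`, so it
    -- is not `vu` and must be on `p`.
    on p shortest with mon (step vu (include p))
      (geodesic⇒shortest {p = step vu (include p)} λ q →
        ≤-trans (s≤s (≤-reflexive (length-include p)))
          (≤-trans (suc-dist-u b≢v q₀ (λ r → <-≤-trans (≰⇒> p₀≰q₀) (geo₀ r)) p
                     (shortest⇒geodesic {p = p} shortest))
                   (geo q)))
    ... | inj₂ o                    = EdgeOn-include p o
    ... | inj₁ (inj₁ (refl , refl)) = contradiction (inj₁ (refl , refl)) (Adj-delete-≢ st)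
    ... | inj₁ (inj₂ (refl , refl)) = contradiction (inj₂ (refl , refl)) (Adj-delete-≢ st)

  MEG-delete-from-v : ∀ {M b s t} → b ≢ v → v ∈ M → b ∈ M → Adj G′ s t →
    Monitors G v b s t →
    ∃ λ x → x ∈ M ∪ ⁅ u ⁆ × b ∈ M ∪ ⁅ u ⁆ × Monitors G′ x b s t
  MEG-delete-from-v {M} b≢v v∈M b∈M st mon with monitors-delete b≢v st mon
  ... | inj₁ mon′ = v , p⊆p∪q _ v∈M , p⊆p∪q _ b∈M , mon′
  ... | inj₂ mon′ = u , q⊆p∪q M _ (x∈⁅x⁆ u) , p⊆p∪q _ b∈M , mon′

  MEG-delete : ∀ {M} → IsMEG G M → IsMEG G′ (M ∪ ⁅ u ⁆)
  MEG-delete {M} meg s t st with meg s t (Adj-delete⁻ st)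
  ... | x , y , x∈M , y∈M , mon with x ≟ v | y ≟ v
  ... | no x≢v   | no y≢v   = x , y , p⊆p∪q _ x∈M , p⊆p∪q _ y∈M ,
                              monitors-off off⁺ off⁻ clique clique′ x≢v y≢v mon
  ... | yes refl | yes refl = contradiction mon ¬monitors-self
  ... | yes refl | no y≢v   = _ , _ , proj₂ (MEG-delete-from-v y≢v x∈M y∈M st mon)
  ... | no x≢v   | yes refl with MEG-delete-from-v x≢v y∈M x∈M st (monitors-sym mon)
  ...   | z , z∈ , x∈ , mon′ = x , z , x∈ , z∈ , monitors-sym mon′

  minMEGSize-delete-≤ : ∀ {k k′} → IsMinMEGSize G k → IsMinMEGSize G′ k′ → k′ ≤ k + 1
  minMEGSize-delete-≤ {k} {k′} ((M , isMEG , ∣M∣≡k) , _) (_ , minimal′) = begin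
    k′                 ≤⟨ minimal′ (M ∪ ⁅ u ⁆) (MEG-delete isMEG) ⟩
    ∣ M ∪ ⁅ u ⁆ ∣      ≤⟨ ∣p∪q∣≤∣p∣+∣q∣ M ⁅ u ⁆ ⟩
    ∣ M ∣ + ∣ ⁅ u ⁆ ∣  ≡⟨ cong₂ _+_ ∣M∣≡k (∣⁅x⁆∣≡1 u) ⟩
    k + 1              ∎
    where open ≤-Reasoning

  -- Lower bound: adding the neighbours of `v` to a MEG-set of `G′`.

  neighbour-monitors : ∀ {b s t} → b ≢ v → s ≢ v → t ≢ v → Monitors G′ v b s t →
                       ∃ λ w → Adj G v w × Monitors G w b s t
  neighbour-monitors b≢v s≢v t≢v mon with geodesic (walk′ {v} b≢v)
  ... | nil , _ = contradiction refl b≢v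
  ... | step {y = w} a q , geo = w , Adj-delete⁻ a ,
    monitors-off off⁻ off⁺ clique′ clique (Adj⇒≢ G′ a ∘ sym) b≢v on
    where
    on : Monitors G′ w _ _ _
    -- Since `w` follows `v` on a geodesic of `G′`, prepending `a` keeps `p` shortest. The first
    -- edge meets `v`, so the monitored edge is on `p`.
    on p shortest with mon (step a p) (geodesic⇒shortest {p = step a p} λ r →
      ≤-trans (s≤s (shortest⇒geodesic {p = p} shortest q)) (geo r))
    ... | inj₂ o                 = o
    ... | inj₁ (inj₁ (v≡s , _)) = contradiction (sym v≡s) s≢v
    ... | inj₁ (inj₂ (v≡t , _)) = contradiction (sym v≡t) t≢v

  MEG-restore-from-v : ∀ {M b s t} → b ≢ v → b ∈ M → s ≢ v → t ≢ v → Monitors G′ v b s t →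
    ∃ λ x → x ∈ M ∪ neighbourhood G v × b ∈ M ∪ neighbourhood G v × Monitors G x b s t
  MEG-restore-from-v {M} b≢v b∈M s≢v t≢v mon with neighbour-monitors b≢v s≢v t≢v mon
  ... | w , a , mon′ = w , q⊆p∪q M _ (Adj⇒∈ G a) , p⊆p∪q _ b∈M , mon′

  MEG-restore : ∀ {M} → IsMEG G′ M → IsMEG G (M ∪ neighbourhood G v)
  MEG-restore {M} meg s t st = split (s ≟ v) (t ≟ v)
    where
    v∈ : v ∈ M ∪ neighbourhood G v
    v∈ = p⊆p∪q _ (∈-MEG walk′ clique′ (proj₂ neighbour′) meg)

    N∈ : ∀ {w} → Adj G v w → w ∈ M ∪ neighbourhood G v
    N∈ a = q⊆p∪q M _ (Adj⇒∈ G a)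

    split : Dec (s ≡ v) → Dec (t ≡ v) → ∃₂ λ x y →
            x ∈ M ∪ neighbourhood G v × y ∈ M ∪ neighbourhood G v × Monitors G x y s t
    -- An edge at `v` is monitored by its own ends, both of which are in the enlarged set.
    split (yes refl) _          = s , t , v∈ , N∈ st , monitors-endpoints st
    split (no _)     (yes refl) = s , t , N∈ (Adj-sym G st) , v∈ , monitors-endpoints st
    -- An edge off `v` is also an edge of `G′`, so `M` supplies a pair for it there.
    split (no s≢v)   (no t≢v) with meg s t (off⁺ s≢v t≢v st)
    ... | x , y , x∈M , y∈M , mon with x ≟ v | y ≟ v
    ... | no x≢v   | no y≢v   = x , y , p⊆p∪q _ x∈M , p⊆p∪q _ y∈M ,
                                monitors-off off⁻ off⁺ clique′ clique x≢v y≢v mon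
    ... | yes refl | yes refl = contradiction mon ¬monitors-self
    ... | yes refl | no y≢v   = _ , _ , proj₂ (MEG-restore-from-v y≢v y∈M s≢v t≢v mon)
    ... | no x≢v   | yes refl
      with MEG-restore-from-v x≢v x∈M s≢v t≢v (monitors-sym mon)
    ...   | z , z∈ , x∈ , mon′ = x , z , x∈ , z∈ , monitors-sym mon′

  minMEGSize-≤-delete : ∀ {k k′} → IsMinMEGSize G k → IsMinMEGSize G′ k′ →
                        k ∸ degree G v ≤ k′
  minMEGSize-≤-delete {k} {k′} (_ , minimal) ((M , isMEG , ∣M∣≡k′) , _) =
    -- The truncated difference is bounded through the additive form of the inequality.
    m≤n+o⇒m∸n≤o k (degree G v) (begin
    k                          ≤⟨ minimal _ (MEG-restore isMEG) ⟩
    ∣ M ∪ neighbourhood G v ∣  ≤⟨ ∣p∪q∣≤∣p∣+∣q∣ M (neighbourhood G v) ⟩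
    ∣ M ∣ + degree G v         ≡⟨ cong (_+ degree G v) ∣M∣≡k′ ⟩
    k′ + degree G v            ≡⟨ +-comm k′ (degree G v) ⟩
    degree G v + k′            ∎)
    where open ≤-Reasoning

theorem4p13 : (n : ℕ) (G : Graph n) → Connected G →
    (v : Fin n) → Simplicial G v → 2 ≤ degree G v →
    (u : Fin n) → Adj G v u →
    (meg G ∸ degree G v ≤ meg (deleteEdge G v u)) × (meg (deleteEdge G v u) ≤ meg G + 1)
theorem4p13 n G connected v simplicial 2≤deg u vu =
  minMEGSize-≤-delete G connected v clique 2≤deg u vu {k} {k′} min min′ ,
  minMEGSize-delete-≤ G connected v clique 2≤deg u vu {k} {k′} min min′
  where
  k = meg G
  k′ = meg (deleteEdge G v u)

  min : IsMinMEGSize G k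
  min = meg-isMin G

  min′ : IsMinMEGSize (deleteEdge G v u) k′
  min′ = meg-isMin (deleteEdge G v u)

  clique : NeighboursAdjacent G v
  clique a b = simplicial _ _ (Adj⇒∈ G a) (Adj⇒∈ G b)
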